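{- Let $t$ be an indeterminate. For every integer $n\ge 0$, $$\sum_{k=0}^n t^k \left(L_k +(t-2)F_{k+1}\right) = t^{n+1}F_{n+1},$$ where $F_k$ and $L_k$ are the $k$th Fibonacci and Lucas numbers.
   Context: The Fibonacci numbers $F_k$ and Lucas numbers $L_k$ ($k\ge 0$) both satisfy $x_{n+2}=x_{n+1}+x_n$ for $n\ge 0$, with initial values $F_0=0$, $F_1=1$ and $L_0=2$, $L_1=1$. -}

module Defs where

open import Algebra.Bundles.Raw using (RawRing)
import Algebra.Definitions.RawSemiring as RawSemiringDefinitions
open import Data.Integer.Base as ℤ using (ℤ; 0ℤ; 1ℤ)
open import Data.List.Base using (List; []; _∷_; map)
open import Data.Nat.Base as ℕ using (ℕ; zero; suc)
open import Level using (0ℓ)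
open import Relation.Binary.PropositionalEquality.Core using (_≡_)

F : ℕ → ℕ
F zero          = 0
F (suc zero)    = 1
F (suc (suc n)) = F (suc n) ℕ.+ F n

L : ℕ → ℕ
L zero          = 2
L (suc zero)    = 1
L (suc (suc n)) = L (suc n) ℕ.+ L n

-- Coefficient lists, constant term first: a₀ ∷ a₁ ∷ … ∷ [] is a₀ + a₁t + ….
Poly : Set
Poly = List ℤ

coeff : Poly → ℕ → ℤ
coeff []      _       = 0ℤ
coeff (a ∷ p) zero    = a
coeff (a ∷ p) (suc i) = coeff p i

-- Trailing zeros are allowed in a list, so polynomials are compared by
-- their coefficients and not by _≡_.
_≈ₚ_ : Poly → Poly → Set
p ≈ₚ q = ∀ i → coeff p i ≡ coeff q i

_+ₚ_ : Poly → Poly → Poly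
[]      +ₚ q       = q
(a ∷ p) +ₚ []      = a ∷ p
(a ∷ p) +ₚ (b ∷ q) = (a ℤ.+ b) ∷ (p +ₚ q)

-- (a + t p) q = a q + t (p q)
_*ₚ_ : Poly → Poly → Poly
[]      *ₚ q = []
(a ∷ p) *ₚ q = map (a ℤ.*_) q +ₚ (0ℤ ∷ (p *ₚ q))

ℤ[t] : RawRing 0ℓ 0ℓ
ℤ[t] = record
  { Carrier = Poly
  ; _≈_     = _≈ₚ_
  ; _+_     = _+ₚ_
  ; _*_     = _*ₚ_
  ; -_      = map (λ a → ℤ.- a)
  ; 0#      = []
  ; 1#      = 1ℤ ∷ []
  }

open RawRing ℤ[t] public using (_≈_; _+_; _*_; -_)
open RawSemiringDefinitions (RawRing.rawSemiring ℤ[t]) public using (_^_; sum)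

infixl 6 _-_

_-_ : Poly → Poly → Poly
p - q = p + (- q)

t : Poly
t = 0ℤ ∷ 1ℤ ∷ []

const : ℤ → Poly
const a = a ∷ []

{-# OPTIONS --safe #-}
-- Since L k = 2 F (k+1) - F k, the k-th summand is t^k (t F (k+1) - F k), so the
-- sum telescopes to t^(n+1) F (n+1) - F 0.  Because t^k * (x ∷ q) is the list
-- x ∷ q preceded by k zeros, with no trailing zeros created, everything holds up
-- to _≡_ on coefficient lists.
module Submission where

open import Defs
open import Data.Fin.Base using (Fin; zero; suc; toℕ)
open import Data.Integer.Base as ℤ using (ℤ; +_; 0ℤ; 1ℤ)
import Data.Integer.Properties as ℤₚ
open import Data.Integer.Tactic.RingSolver using (solve-∀)
open import Data.List.Base using ([]; _∷_; _++_; length; map; replicate)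
open import Data.List.Properties using (map-id; map-cong)
open import Data.Nat.Base as ℕ using (ℕ; zero; suc; _≤_; s≤s)
import Data.Nat.Properties as ℕₚ
open import Relation.Binary.PropositionalEquality

open ≡-Reasoning

infixr 5 _⟫_

_⟫_ : ℕ → Poly → Poly
k ⟫ q = replicate k 0ℤ ++ q

length-⟫ : ∀ k q → length q ≤ length (k ⟫ q)
length-⟫ zero    q = ℕₚ.≤-refl
length-⟫ (suc k) q = ℕₚ.m≤n⇒m≤1+n (length-⟫ k q)

-- Multiplying by a leading `0ℤ` leaves a list of zeros, not `[]`; the length bound keeps them from
-- extending `r`.
0*-+ : ∀ q r → length q ≤ length r → map (0ℤ ℤ.*_) q + r ≡ r
0*-+ []      r       _         = refl
0*-+ (x ∷ q) (y ∷ r) (s≤s q≤r) =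
  cong₂ _∷_ (trans (cong (ℤ._+ y) (ℤₚ.*-zeroˡ x)) (ℤₚ.+-identityˡ y)) (0*-+ q r q≤r)

+-identityʳ : ∀ p → p + [] ≡ p
+-identityʳ []      = refl
+-identityʳ (x ∷ p) = refl

1*-identity : ∀ x q → const 1ℤ * (x ∷ q) ≡ x ∷ q
1*-identity x q = cong₂ _∷_
  (trans (ℤₚ.+-identityʳ _) (ℤₚ.*-identityˡ x))
  (trans (+-identityʳ _) (trans (map-cong ℤₚ.*-identityˡ q) (map-id q)))

0∷-* : ∀ p x q → length q ≤ length (p * (x ∷ q)) → (0ℤ ∷ p) * (x ∷ q) ≡ 0ℤ ∷ p * (x ∷ q)
0∷-* p x q q≤ = cong₂ _∷_ (trans (ℤₚ.+-identityʳ _) (ℤₚ.*-zeroˡ x)) (0*-+ q _ q≤)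

-- The right factor must be nonempty: `const 1ℤ * []` computes to `0ℤ ∷ []`.
monomial-* : ∀ k x q → (k ⟫ const 1ℤ) * (x ∷ q) ≡ k ⟫ x ∷ q
monomial-* zero    x q = 1*-identity x q
monomial-* (suc k) x q = trans
  (0∷-* (k ⟫ const 1ℤ) x q
    (subst (λ r → length q ≤ length r) (sym (monomial-* k x q))
      (ℕₚ.≤-trans (ℕₚ.n≤1+n _) (length-⟫ k (x ∷ q)))))
  (cong (0ℤ ∷_) (monomial-* k x q))

t^-monomial : ∀ k → t ^ k ≡ k ⟫ const 1ℤ
t^-monomial zero          = refl
t^-monomial (suc zero)    = refl
-- `t` is `1 ⟫ const 1ℤ`, and an exponent of at least one exposes the head `0ℤ` of the right factor.
t^-monomial (suc (suc k)) = trans (cong (t *_) (t^-monomial (suc k)))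
  (monomial-* 1 0ℤ (k ⟫ const 1ℤ))

t^-* : ∀ k x q → t ^ k * (x ∷ q) ≡ k ⟫ x ∷ q
t^-* k x q = trans (cong (_* (x ∷ q)) (t^-monomial k)) (monomial-* k x q)

sum-cong : ∀ {n} {f g : Fin n → Poly} → (∀ k → f k ≡ g k) → sum f ≡ sum g
sum-cong {zero}  f≡g = refl
sum-cong {suc n} f≡g = cong₂ _+_ (f≡g zero) (sum-cong (λ k → f≡g (suc k)))

sum-0∷ : ∀ {n} (f : Fin (suc n) → Poly) → sum (λ k → 0ℤ ∷ f k) ≡ 0ℤ ∷ sum f
sum-0∷ {zero}  f = cong (0ℤ ∷_) (sym (+-identityʳ (f zero)))
sum-0∷ {suc n} f = cong (λ r → (0ℤ ∷ f zero) + r) (sum-0∷ (λ k → f (suc k)))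

-- Stated for arbitrary `u` because the induction shifts it: all summands but the first start with
-- `0ℤ`, and dropping that zero leaves the same sum for `λ k → u (suc k)`.
sum-telescope : ∀ (u : ℕ → ℤ) n →
  sum {suc n} (λ k → toℕ k ⟫ ℤ.- u (toℕ k) ∷ u (suc (toℕ k)) ∷ []) ≡ ℤ.- u 0 ∷ (n ⟫ const (u (suc n)))
sum-telescope u zero    = refl
sum-telescope u (suc n) = begin
  (ℤ.- u 0 ∷ u 1 ∷ []) + sum (λ k → 0ℤ ∷ f k)
    ≡⟨ cong (λ r → (ℤ.- u 0 ∷ u 1 ∷ []) + r) (trans (sum-0∷ f) (cong (0ℤ ∷_) (sum-telescope (λ k → u (suc k)) n))) ⟩
  ℤ.- u 0 ℤ.+ 0ℤ ∷ u 1 ℤ.- u 1 ∷ (n ⟫ const (u (suc (suc n))))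
    -- The telescoping cancellation: `u 1` from the first summand meets the head of the shifted sum.
    ≡⟨ cong₂ (λ x y → x ∷ y ∷ (n ⟫ const (u (suc (suc n))))) (ℤₚ.+-identityʳ _) (ℤₚ.+-inverseʳ (u 1)) ⟩
  ℤ.- u 0 ∷ 0ℤ ∷ (n ⟫ const (u (suc (suc n)))) ∎
  where
  f : Fin (suc n) → Poly
  f k = toℕ k ⟫ ℤ.- u (suc (toℕ k)) ∷ u (suc (suc (toℕ k))) ∷ []

-- L k = 2 F (k+1) - F k, with both sides moved so that no subtraction occurs.
L+F≡2F : ∀ k → L k ℕ.+ F k ≡ F (suc k) ℕ.+ F (suc k)
L+F≡2F zero          = refl
L+F≡2F (suc zero)    = refl
L+F≡2F (suc (suc k)) = begin
  (L (suc k) ℕ.+ L k) ℕ.+ (F (suc k) ℕ.+ F k)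
    ≡⟨ interchange (L (suc k)) (L k) (F (suc k)) (F k) ⟩
  (L (suc k) ℕ.+ F (suc k)) ℕ.+ (L k ℕ.+ F k)
    ≡⟨ cong₂ ℕ._+_ (L+F≡2F (suc k)) (L+F≡2F k) ⟩
  (F (suc (suc k)) ℕ.+ F (suc (suc k))) ℕ.+ (F (suc k) ℕ.+ F (suc k))
    ≡⟨ interchange (F (suc (suc k))) (F (suc (suc k))) (F (suc k)) (F (suc k)) ⟩
  F (suc (suc (suc k))) ℕ.+ F (suc (suc (suc k))) ∎
  where open import Algebra.Properties.CommutativeSemigroup ℕₚ.+-commutativeSemigroup using (interchange)

-- The left side is the constant coefficient in `factor` exactly as `_+_` and `_*_` compute it,
-- including the `0ℤ`.
L-2F≡-F : ∀ k → + L k ℤ.+ (ℤ.- (+ 2) ℤ.* + F (suc k) ℤ.+ 0ℤ) ≡ ℤ.- (+ F k)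
L-2F≡-F k = begin
  + L k ℤ.+ (ℤ.- (+ 2) ℤ.* + F (suc k) ℤ.+ 0ℤ)
    ≡⟨ expand (+ L k) (+ F k) (+ F (suc k)) ⟩
  (+ (L k ℕ.+ F k) ℤ.- + (F (suc k) ℕ.+ F (suc k))) ℤ.- + F k
    ≡⟨ cong (λ m → (+ m ℤ.- + (F (suc k) ℕ.+ F (suc k))) ℤ.- + F k) (L+F≡2F k) ⟩
  (+ (F (suc k) ℕ.+ F (suc k)) ℤ.- + (F (suc k) ℕ.+ F (suc k))) ℤ.- + F k
    ≡⟨ cong (ℤ._- + F k) (ℤₚ.+-inverseʳ (+ (F (suc k) ℕ.+ F (suc k)))) ⟩
  0ℤ ℤ.- + F k
    ≡⟨ ℤₚ.+-identityˡ _ ⟩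
  ℤ.- (+ F k) ∎
  where
  expand : ∀ l f g → l ℤ.+ (ℤ.- (+ 2) ℤ.* g ℤ.+ 0ℤ) ≡ ((l ℤ.+ f) ℤ.- (g ℤ.+ g)) ℤ.- f
  expand = solve-∀

factor : ∀ k →
  const (+ L k) + (t - const (+ 2)) * const (+ F (suc k)) ≡ ℤ.- (+ F k) ∷ + F (suc k) ∷ []
factor k = cong₂ (λ x y → x ∷ y ∷ []) (L-2F≡-F k)
  (trans (ℤₚ.+-identityʳ _) (ℤₚ.*-identityˡ (+ F (suc k))))

mainTheorem2 : (n : ℕ) →
    sum {suc n} (λ k → t ^ toℕ k * (const (+ L (toℕ k)) + (t - const (+ 2)) * const (+ F (suc (toℕ k)))))
    ≈ t ^ suc n * const (+ F (suc n))
mainTheorem2 n i = cong (λ p → coeff p i) (begin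
  sum {suc n} (λ k → t ^ toℕ k * (const (+ L (toℕ k)) + (t - const (+ 2)) * const (+ F (suc (toℕ k)))))
    ≡⟨ sum-cong {suc n} (λ k → trans (cong (t ^ toℕ k *_) (factor (toℕ k))) (t^-* (toℕ k) _ _)) ⟩
  sum {suc n} (λ k → toℕ k ⟫ ℤ.- (+ F (toℕ k)) ∷ + F (suc (toℕ k)) ∷ [])
    -- The head `ℤ.- (+ F 0)` computes to `0ℤ`, which supplies the extra zero turning `n ⟫` into
    -- `suc n ⟫`.
    ≡⟨ sum-telescope (λ k → + F k) n ⟩
  suc n ⟫ const (+ F (suc n))
    ≡⟨ t^-* (suc n) _ _ ⟨
  t ^ suc n * const (+ F (suc n)) ∎)
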